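{- For every integer constant $d \ge 1$ there exists a constant $k$ such that $k$-Hamming Distance cannot be reduced to $\mathsf{IIP}_d$; that is, $\mathsf{D}^{\mathsf{IIP}_d}(\mathsf{EHD}_k) = O(1)$ does not hold.
   Context: $\mathsf{dist}(x,y)$ denotes Hamming distance. For an integer $k \ge 0$, the (exact) $k$-Hamming Distance problem is $\mathsf{EHD}_k = (\mathsf{EHD}_k^n)_{n\in\mathbb{N}}$, where $\mathsf{EHD}_k^n$ is the $2^n \times 2^n$ Boolean matrix with rows and columns indexed by $\{0,1\}^n$ and $\mathsf{EHD}_k^n(x,y) = 1$ if and only if $\mathsf{dist}(x,y) = k$. For fixed $d$, the Integer Inner Product problem is $\mathsf{IIP}_d = (\mathsf{IIP}_d^n)_{n\in\mathbb{N}}$, where $\mathsf{IIP}_d^n$ is the $2^{dn}\times 2^{dn}$ Boolean matrix with rows and columns indexed by $\{0,1\}^{dn}$; $x,y \in \{0,1\}^{dn}$ are interpreted as binary ($n$ bits per coordinate, two's complement) representations of integer vectors $x=(x_1,\dots,x_d)$, $y=(y_1,\dots,y_d)$ with coordinates in $\{ -2^{n-1},\dots,2^{n-1}-1\}$, and $\mathsf{IIP}_d^n(x,y) = 0$ if $\langle x,y\rangle = \sum_i x_i y_i = 0$, and $1$ otherwise. For a set $\mathcal{M}$ of Boolean matrices (a communication problem, i.e. a sequence of square Boolean matrices, is also regarded as the set of its matrices), the query set $\mathsf{QS}(\mathcal{M})$ is the set of all matrices obtained from matrices in $\mathcal{M}$ by the operations: arbitrary row and column permutations; taking arbitrary submatrices;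 duplicating arbitrary rows or columns. For $P \in \{0,1\}^{N \times N}$, a deterministic communication protocol with oracle access to $\mathcal{M}$ is a binary tree in which each inner node $v$ is associated with an $N \times N$ matrix $Q_v \in \mathsf{QS}(\mathcal{M})$ (with the same row and column index sets as $P$) and each leaf $\ell$ with a bit $b_\ell \in \{0,1\}$. An input $(x,y)$ defines a root-to-leaf path: at node $v$ the entry $Q_v(x,y)$ decides whether to go left or right; the output is the bit of the leaf reached. The protocol computes $P$ if the output is $P(x,y)$ for every $(x,y)$. Its cost is the depth of the tree, and $\mathsf{D}^{\mathcal{M}}(P)$ is the minimum cost of such a protocol computing $P$ ($\infty$ if there is none). A problem $\mathcal{P}=(P_n)_n$ reduces to $\mathcal{Q}$ if $\mathsf{D}^{\mathcal{Q}}(\mathcal{P}) = O(1)$, i.e. there is a constant $c$ with $\mathsf{D}^{\mathcal{Q}}(P_n) \le c$ for all $n$. -}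

module Defs where

open import Algebra.Definitions.RawMonoid using (sum)
open import Data.Bool.Base using (Bool; true; false; not; if_then_else_)
open import Data.Fin.Base using (Fin; toℕ; combine; finToFun; funToFin; pinch)
open import Data.Fin.Permutation using (Permutation′; _⟨$⟩ʳ_)
import Data.Fin.Properties as Fin
open import Data.Integer.Base as ℤ using (ℤ; +_; 0ℤ)
import Data.Integer.Properties as ℤ
open import Data.Nat.Base using (ℕ; zero; suc; _*_; _^_; _⊔_; _≤_; +-0-rawMonoid)
import Data.Nat.Properties as ℕ
open import Data.Product.Base using (Σ-syntax; ∃-syntax; _×_)
open import Data.Vec.Functional using (Vector; head; tail)
open import Function.Definitions using (Injective)
open import Relation.Binary.PropositionalEquality.Core using (_≡_)
open import Relation.Nullary.Decidable.Core using (does)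

-- Entries: false is 0, true is 1.
Matrix : ℕ → ℕ → Set
Matrix m n = Fin m → Fin n → Bool

MatrixSet : Set₁
MatrixSet = ∀ {m n} → Matrix m n → Set

record Problem : Set where
  field
    size   : ℕ → ℕ
    matrix : ∀ n → Matrix (size n) (size n)

open Problem public

data Matrices (𝓟 : Problem) : MatrixSet where
  member : ∀ n → Matrices 𝓟 (matrix 𝓟 n)

data QS (𝓜 : MatrixSet) : MatrixSet where
  base : ∀ {m n} {A : Matrix m n} → 𝓜 A → QS 𝓜 A
  permuteRows : ∀ {m n} {A : Matrix m n} (π : Permutation′ m) →
                QS 𝓜 A → QS 𝓜 (λ i j → A (π ⟨$⟩ʳ i) j)
  permuteCols : ∀ {m n} {A : Matrix m n} (π : Permutation′ n) →
                QS 𝓜 A → QS 𝓜 (λ i j → A i (π ⟨$⟩ʳ j))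
  submatrix : ∀ {m n m′ n′} {A : Matrix m n}
              (r : Fin m′ → Fin m) (c : Fin n′ → Fin n) →
              Injective _≡_ _≡_ r → Injective _≡_ _≡_ c →
              QS 𝓜 A → QS 𝓜 (λ i j → A (r i) (c j))
  -- pinch r hits r exactly twice and every other index exactly once.
  duplicateRow : ∀ {m n} {A : Matrix m n} (r : Fin m) →
                 QS 𝓜 A → QS 𝓜 (λ i j → A (pinch r i) j)
  duplicateCol : ∀ {m n} {A : Matrix m n} (c : Fin n) →
                 QS 𝓜 A → QS 𝓜 (λ i j → A i (pinch c j))

data Protocol (𝓜 : MatrixSet) (N : ℕ) : Set where
  leaf : Bool → Protocol 𝓜 N
  node : (Q : Matrix N N) → QS 𝓜 Q →
         (left right : Protocol 𝓜 N) → Protocol 𝓜 N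

module _ {𝓜 : MatrixSet} {N : ℕ} where

  output : Protocol 𝓜 N → Matrix N N
  output (leaf b)              x y = b
  output (node Q _ left right) x y =
    if Q x y then output right x y else output left x y

  cost : Protocol 𝓜 N → ℕ
  cost (leaf _)              = 0
  cost (node _ _ left right) = suc (cost left ⊔ cost right)

  Computes : Protocol 𝓜 N → Matrix N N → Set
  Computes Π P = ∀ x y → output Π x y ≡ P x y

-- D[ 𝓜 ] P ≤ c unfolds the bound "the minimum cost is at most c", where the
-- minimum over the empty set is ∞: some protocol computing P has cost ≤ c.
D[_]_≤_ : MatrixSet → ∀ {N} → Matrix N N → ℕ → Set
D[_]_≤_ 𝓜 {N} P c = Σ[ Π ∈ Protocol 𝓜 N ] Computes Π P × cost Π ≤ c

_ReducesTo_ : Problem → Problem → Set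
𝓟 ReducesTo 𝓠 = ∃[ c ] ∀ n → D[ Matrices 𝓠 ] matrix 𝓟 n ≤ c

BitString : ℕ → Set
BitString = Vector (Fin 2)

-- Rows and columns indexed by {0,1}ⁿ are numbered by Fin (2 ^ n) through the
-- library's bijection finToFun, with inverse funToFin.
bits : ∀ {n} → Fin (2 ^ n) → BitString n
bits = finToFun

dist : ∀ {n} → BitString n → BitString n → ℕ
dist x y = sum +-0-rawMonoid (λ i → if does (x i Fin.≟ y i) then 0 else 1)

EHD : ℕ → Problem
EHD k .size   n     = 2 ^ n
EHD k .matrix n x y = does (dist (bits {n} x) (bits y) ℕ.≟ k)

-- Bits are listed from the most significant one, as in funToFin, whose value is
-- the unsigned reading; the leading bit of n + 1 bits has weight - 2ⁿ.
-- The empty string, which has no two's complement reading, is given value 0.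
twosComplement : ∀ {n} → BitString n → ℤ
twosComplement {zero}  b = 0ℤ
twosComplement {suc n} b =
  + toℕ (funToFin (tail b)) ℤ.- + (toℕ (head b) * 2 ^ n)

-- The i-th coordinate is read from the i-th block of n consecutive bits.
integerVector : ∀ d n → BitString (d * n) → Vector ℤ d
integerVector d n b i = twosComplement (λ (j : Fin n) → b (combine i j))

⟨_,_⟩ : ∀ {d} → Vector ℤ d → Vector ℤ d → ℤ
⟨ x , y ⟩ = sum ℤ.+-0-rawMonoid (λ i → x i ℤ.* y i)

IIP : ℕ → Problem
IIP d .size   n     = 2 ^ (d * n)
IIP d .matrix n x y =
  not (does (⟨ integerVector d n (bits x) , integerVector d n (bits y) ⟩ ℤ.≟ 0ℤ))

module Submission where

-- Label the blocks of a long string by 1, …, n and give each block three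
-- positions x < y < z. A set S of blocks codes a row (a one at x in the blocks
-- of S, at y in the others), and a set T codes a column (a one at z in the
-- blocks of T, at y in the others); their distance is 2 |S ∪ T|. By Ramsey's
-- theorem the positions can be chosen so that the answers to all queries of a
-- protocol of bounded cost depend only on S ∪ T, and by a second application
-- there is a set M of d + 1 blocks such that they agree on all the facets M ∖ {j}.
-- With S = M ∖ {first i elements} and T = M ∖ {j}, the union is a facet if j
-- precedes position i and M otherwise. Computing EHD with k = 2 d means telling
-- facets from M, so a single query has a (d + 1)-step staircase of zeros and
-- nonzeros as a submatrix. But vectors in ℤᵈ have no staircase of orthogonality
-- with more than d steps.

open import Defs
import Algebra.Properties.CommutativeMonoid.Sum
open import Data.Bool.Base using (Bool; true; false; not; if_then_else_)
import Data.Bool.Properties as Bool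
open import Data.Empty using (⊥-elim)
open import Data.Fin.Base as Fin using (Fin; zero; suc; toℕ; funToFin)
open import Data.Fin.Permutation using (_⟨$⟩ʳ_)
import Data.Fin.Properties as Fin
open import Data.Fin.Subset using (Subset; ⁅_⁆; _∪_; ∣_∣; ⊥) renaming (_∉_ to _∉ₛ_)
open import Data.Fin.Subset.Properties
  using (∪-assoc; ∪-comm; ∪-idem; ∪-identityˡ; ∣⊥∣≡0; ∉⊥; x∈p∪q⁻; x∈⁅y⁆⇒x≡y)
open import Data.Integer.Base as ℤ using (ℤ; 0ℤ)
import Data.Integer.Properties as ℤ
open import Data.Integer.Tactic.RingSolver using (solve-∀)
open import Data.List.Base
  using (List; []; _∷_; _++_; map; length; drop; removeAt; upTo; allFin; cartesianProduct)
open import Data.List.Membership.Propositional using (_∈_)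
open import Data.List.Membership.Propositional.Properties
  using (∈-++⁺ˡ; ∈-++⁺ʳ; ∈-map⁺; ∈-upTo⁺; ∈-cartesianProduct⁺)
open import Data.List.Properties using (length-removeAt; length-tabulate)
open import Data.List.Relation.Binary.Sublist.Propositional
  using (_⊆_; []; _∷_; _∷ʳ_; ⊆-refl; ⊆-trans; minimum)
open import Data.List.Relation.Binary.Sublist.Propositional.Properties using (All-resp-⊆)
open import Data.List.Relation.Unary.All as All using (All; []; _∷_)
open import Data.List.Relation.Unary.AllPairs as AllPairs using ([]; _∷_)
open import Data.List.Relation.Unary.Any using (here)
open import Data.List.Relation.Unary.Unique.Propositional using (Unique)
open import Data.List.Relation.Unary.Unique.Propositional.Properties using (allFin⁺)
open import Data.Nat.Base as ℕ
  using (ℕ; zero; suc; _+_; _*_; _⊔_; _^_; _≤_; _<_; z≤n; s≤s)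
open import Data.Nat.GeneralisedArithmetic using (fold)
import Data.Nat.Properties as ℕ
open import Data.Product.Base using (∃; ∃₂; ∃-syntax; _×_; _,_)
open import Data.Sum.Base using (inj₁; inj₂)
open import Data.Vec.Base using ([]; _∷_; here; there)
import Data.Vec.Functional as Vector
open import Data.Vec.Functional using (Vector)
open import Function.Base using (_∘_; id)
open import Relation.Binary.PropositionalEquality
open import Relation.Nullary.Decidable using (does; yes; no; dec-true; dec-false)
open import Relation.Nullary.Negation.Core using (¬_; contradiction)

private
  module ℤΣ = Algebra.Properties.CommutativeMonoid.Sum ℤ.+-0-commutativeMonoid
  module ℕΣ = Algebra.Properties.CommutativeMonoid.Sum ℕ.+-0-commutativeMonoid

private variable
  A I : Set

-- Ramsey's theorem for sublists

-- Sublists of length `r` play the part of `r`-element subsets.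
Monochromatic : ℕ → (List A → Bool) → Bool → List A → Set
Monochromatic r χ b H = ∀ {s} → s ⊆ H → length s ≡ r → χ s ≡ b

mono-⊆ : ∀ {r χ b} {H G : List A} → H ⊆ G → Monochromatic r χ b G → Monochromatic r χ b H
mono-⊆ H⊆G mono s⊆H = mono (⊆-trans s⊆H H⊆G)

-- A sublist of `x ∷ H` either avoids `x`, or is `x` followed by a sublist of `H` one element
-- shorter; the link colouring of `x` governs the second kind.
mono-∷ : ∀ {r χ b x} {H : List A} → Monochromatic r (χ ∘ (x ∷_)) b H →
         Monochromatic (suc r) χ b H → Monochromatic (suc r) χ b (x ∷ H)
mono-∷ link mono (_ ∷ʳ s⊆H)   len = mono s⊆H len
mono-∷ link mono (refl ∷ s⊆H) len = link s⊆H (ℕ.suc-injective len)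

mono-[] : ∀ {r} {χ : List A → Bool} {b} → Monochromatic (suc r) χ b []
mono-[] [] ()

-- A size that suffices, with no claim to be optimal. Each round spends one element as the head of
-- the list and `ramseyNumber r N` elements on making its link monochromatic; `m + m` rounds fill
-- one of two colour classes of size `m`.
ramseyNumber : ℕ → ℕ → ℕ
ramseyNumber zero    m = m
ramseyNumber (suc r) m = fold 0 (λ N → suc (ramseyNumber r N)) (m + m)

mutual

  ramsey : ∀ r {m} (χ : List A → Bool) {L} → length L ≡ ramseyNumber r m →
           ∃₂ λ H b → H ⊆ L × length H ≡ m × Monochromatic r χ b H
  ramsey zero χ {L} len = L , χ [] , ⊆-refl , len , λ { {[]} _ _ → refl }
  ramsey (suc r) {m} χ len with ramsey-offDiagonal r (m + m) m m refl χ len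
  ... | true  , H , rest = H , true  , rest
  ... | false , H , rest = H , false , rest

  -- The size only depends on m + m′, so that one link serves both recursive calls.
  ramsey-offDiagonal : ∀ r p m m′ → m + m′ ≡ p → (χ : List A → Bool) → ∀ {L} →
    length L ≡ fold 0 (λ N → suc (ramseyNumber r N)) p →
    ∃₂ λ b H → H ⊆ L × length H ≡ (if b then m else m′) × Monochromatic (suc r) χ b H
  ramsey-offDiagonal r p zero m′ eq χ len = true , [] , minimum _ , refl , mono-[] {χ = χ}
  ramsey-offDiagonal r p (suc m) zero eq χ len = false , [] , minimum _ , refl , mono-[] {χ = χ}
  ramsey-offDiagonal r (suc p) (suc m) (suc m′) eq χ {x ∷ L} len
    -- `G` is a part of the tail on which the link of `x` has a single colour. A set of that colour
    -- found in `G` can be extended by `x`, so the target for that colour drops by one.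
    with ramsey r (χ ∘ (x ∷_)) (ℕ.suc-injective len)
  ... | G , true , G⊆L , lenG , link
    with ramsey-offDiagonal r p m (suc m′) (ℕ.suc-injective eq) χ lenG
  ...   | true  , H , H⊆G , lenH , mono =
          true , x ∷ H , refl ∷ ⊆-trans H⊆G G⊆L , cong suc lenH ,
          mono-∷ {χ = χ} (mono-⊆ {χ = χ ∘ (x ∷_)} H⊆G link) mono
  ...   | false , H , H⊆G , lenH , mono =
          false , H , x ∷ʳ ⊆-trans H⊆G G⊆L , lenH , mono
  ramsey-offDiagonal r (suc p) (suc m) (suc m′) eq χ {x ∷ L} len
      | G , false , G⊆L , lenG , link
    with ramsey-offDiagonal r p (suc m) m′ (trans (sym (ℕ.+-suc m m′)) (ℕ.suc-injective eq)) χ lenG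
  ...   | true  , H , H⊆G , lenH , mono =
          true , H , x ∷ʳ ⊆-trans H⊆G G⊆L , lenH , mono
  ...   | false , H , H⊆G , lenH , mono =
          false , x ∷ H , refl ∷ ⊆-trans H⊆G G⊆L , cong suc lenH ,
          mono-∷ {χ = χ} (mono-⊆ {χ = χ ∘ (x ∷_)} H⊆G link) mono

ramseyNumbers : ℕ → List I → ℕ → ℕ
ramseyNumbers r []       m = m
ramseyNumbers r (_ ∷ is) m = ramseyNumber r (ramseyNumbers r is m)

-- The colourings are treated one after another: passing to a sublist keeps the earlier ones
-- monochromatic. The colour may vary with `i`.
ramsey-all : ∀ r (is : List I) {m} (χ : I → List A → Bool) {L} → length L ≡ ramseyNumbers r is m →
             ∃[ H ] H ⊆ L × length H ≡ m × All (λ i → ∃[ b ] Monochromatic r (χ i) b H) is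
ramsey-all r []       χ {L} len = L , ⊆-refl , len , []
ramsey-all r (i ∷ is) χ len with ramsey r (χ i) len
... | G , b , G⊆L , lenG , mono with ramsey-all r is χ lenG
...   | H , H⊆G , lenH , monos =
        H , ⊆-trans H⊆G G⊆L , lenH , (b , mono-⊆ {χ = χ i} H⊆G mono) ∷ monos

-- Orthogonality in ℤᵈ

inner-comm : ∀ {d} (x y : Vector ℤ d) → ⟨ x , y ⟩ ≡ ⟨ y , x ⟩
inner-comm x y = ℤΣ.sum-cong-≗ (λ i → ℤ.*-comm (x i) (y i))

inner-zeroˡ : ∀ {d} (x y : Vector ℤ d) → (∀ i → x i ≡ 0ℤ) → ⟨ x , y ⟩ ≡ 0ℤ
inner-zeroˡ {zero}  x y x≡0 = refl
inner-zeroˡ {suc d} x y x≡0 =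
  cong₂ ℤ._+_ (cong (ℤ._* y zero) (x≡0 zero)) (inner-zeroˡ (x ∘ suc) (y ∘ suc) (x≡0 ∘ suc))

inner-linear : ∀ {d} α β (a b w : Vector ℤ d) →
  ⟨ (λ l → α ℤ.* b l ℤ.- β ℤ.* a l) , w ⟩ ≡ α ℤ.* ⟨ b , w ⟩ ℤ.- β ℤ.* ⟨ a , w ⟩
inner-linear {zero} α β a b w = nil α β
  where
  nil : ∀ α β → 0ℤ ≡ α ℤ.* 0ℤ ℤ.- β ℤ.* 0ℤ
  nil = solve-∀
inner-linear {suc d} α β a b w = trans
  (cong (λ S → (α ℤ.* b zero ℤ.- β ℤ.* a zero) ℤ.* w zero ℤ.+ S)
    (inner-linear α β (a ∘ suc) (b ∘ suc) (w ∘ suc)))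
  (step α β (a zero) (b zero) (w zero) _ _)
  where
  step : ∀ α β x y z S T → (α ℤ.* y ℤ.- β ℤ.* x) ℤ.* z ℤ.+ (α ℤ.* S ℤ.- β ℤ.* T)
                        ≡ α ℤ.* (y ℤ.* z ℤ.+ S) ℤ.- β ℤ.* (x ℤ.* z ℤ.+ T)
  step = solve-∀

-- Gaussian elimination of coordinate p, with pivot a p.
eliminate : ∀ {d} → Fin (suc d) → (a b : Vector ℤ (suc d)) → Vector ℤ d
eliminate p a b l = a p ℤ.* Vector.removeAt b p l ℤ.- b p ℤ.* Vector.removeAt a p l

-- The combination of `a` and `b` vanishes at coordinate `p`, so deleting that coordinate leaves its
-- product with `w` unchanged, and the term with `⟨ a , w ⟩` drops out.
inner-eliminate : ∀ {d} p (a b w : Vector ℤ (suc d)) → ⟨ a , w ⟩ ≡ 0ℤ →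
                  ⟨ eliminate p a b , Vector.removeAt w p ⟩ ≡ a p ℤ.* ⟨ b , w ⟩
inner-eliminate p a b w a⊥w = begin
  ⟨ eliminate p a b , Vector.removeAt w p ⟩
    ≡⟨ inner-linear (a p) (b p) (Vector.removeAt a p) (Vector.removeAt b p) (Vector.removeAt w p) ⟩
  a p ℤ.* S ℤ.- b p ℤ.* T
    ≡⟨ pad (a p) (b p) (w p) S T ⟩
  a p ℤ.* (b p ℤ.* w p ℤ.+ S) ℤ.- b p ℤ.* (a p ℤ.* w p ℤ.+ T)
    ≡⟨ cong₂ (λ x y → a p ℤ.* x ℤ.- b p ℤ.* y) (ℤΣ.sum-remove {i = p} (λ i → b i ℤ.* w i))
             (trans (sym a⊥w) (ℤΣ.sum-remove {i = p} (λ i → a i ℤ.* w i))) ⟨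
  a p ℤ.* ⟨ b , w ⟩ ℤ.- b p ℤ.* 0ℤ
    ≡⟨ tidy (a p ℤ.* ⟨ b , w ⟩) (b p) ⟩
  a p ℤ.* ⟨ b , w ⟩ ∎
  where
  open ≡-Reasoning
  S T : ℤ
  S = ⟨ Vector.removeAt b p , Vector.removeAt w p ⟩
  T = ⟨ Vector.removeAt a p , Vector.removeAt w p ⟩
  pad : ∀ x y z S T → x ℤ.* S ℤ.- y ℤ.* T ≡ x ℤ.* (y ℤ.* z ℤ.+ S) ℤ.- y ℤ.* (x ℤ.* z ℤ.+ T)
  pad = solve-∀
  tidy : ∀ x y → x ℤ.- y ℤ.* 0ℤ ≡ x
  tidy = solve-∀

-- A triangular matrix with nonzero diagonal has full rank `m`, while products of vectors in ℤᵈ have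
-- rank at most `d`. The induction eliminates with `u zero`, which is orthogonal to all later `v j`;
-- this only multiplies the remaining products by the pivot.
triangular-bound : ∀ {d m} (u v : Fin m → Vector ℤ d) → (∀ i → ⟨ u i , v i ⟩ ≢ 0ℤ) →
                   (∀ {i j} → i Fin.< j → ⟨ u i , v j ⟩ ≡ 0ℤ) → m ≤ d
triangular-bound {d}     {zero}  u v diag upper = z≤n
triangular-bound {zero}  {suc m} u v diag upper = contradiction refl (diag zero)
triangular-bound {suc d} {suc m} u v diag upper
  -- A pivot exists because `u zero` has a nonzero product with `v zero`.
  with Fin.¬∀⟶∃¬ (suc d) (λ i → u zero i ≡ 0ℤ) (λ i → u zero i ℤ.≟ 0ℤ)
         (diag zero ∘ inner-zeroˡ (u zero) (v zero))
... | p , pivot = s≤s (triangular-bound u′ v′ diag′ upper′)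
  where
  u′ v′ : Fin m → Vector ℤ d
  u′ i = eliminate p (u zero) (u (suc i))
  v′ j = Vector.removeAt (v (suc j)) p
  scaled : ∀ i j → ⟨ u′ i , v′ j ⟩ ≡ u zero p ℤ.* ⟨ u (suc i) , v (suc j) ⟩
  scaled i j = inner-eliminate p (u zero) (u (suc i)) (v (suc j)) (upper {zero} {suc j} (s≤s z≤n))
  diag′ : ∀ i → ⟨ u′ i , v′ i ⟩ ≢ 0ℤ
  diag′ i eq = diag (suc i) (ℤ.*-cancelˡ-≡ (u zero p) _ _ {{ℤ.≢-nonZero pivot}}
    (trans (sym (scaled i i)) (trans eq (sym (ℤ.*-zeroʳ (u zero p))))))
  upper′ : ∀ {i j} → i Fin.< j → ⟨ u′ i , v′ j ⟩ ≡ 0ℤ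
  upper′ {i} {j} i<j = trans (scaled i j)
    (trans (cong (u zero p ℤ.*_) (upper {suc i} {suc j} (s≤s i<j))) (ℤ.*-zeroʳ (u zero p)))

-- Every query set operation merely reindexes rows or columns, and the vectors are reindexed along
-- with them.
QS-inner : ∀ {d m n} {Q : Matrix m n} → QS (Matrices (IIP d)) Q →
  ∃₂ λ (u : Fin m → Vector ℤ d) (v : Fin n → Vector ℤ d) →
  ∀ i j → Q i j ≡ not (does (⟨ u i , v j ⟩ ℤ.≟ 0ℤ))
QS-inner {d} (base (member n)) =
  integerVector d n ∘ bits , integerVector d n ∘ bits , λ _ _ → refl
QS-inner (permuteRows π q)       with QS-inner q
... | u , v , eq = u ∘ (π ⟨$⟩ʳ_) , v , λ i j → eq _ j
QS-inner (permuteCols π q)       with QS-inner q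
... | u , v , eq = u , v ∘ (π ⟨$⟩ʳ_) , λ i j → eq i _
QS-inner (submatrix r c _ _ q)   with QS-inner q
... | u , v , eq = u ∘ r , v ∘ c , λ i j → eq _ _
QS-inner (duplicateRow r q)      with QS-inner q
... | u , v , eq = u ∘ Fin.pinch r , v , λ i j → eq _ j
QS-inner (duplicateCol c q)      with QS-inner q
... | u , v , eq = u , v ∘ Fin.pinch c , λ i j → eq i _

-- There are `k` columns and the relevant rows are 0, ..., `k`. This spare row yields a triangular
-- `k` by `k` submatrix with nonzero diagonal whichever side of the staircase is orthogonal.
QS-IIP-staircase : ∀ {d k m n} {Q : Matrix m n} → QS (Matrices (IIP d)) Q →
  (x : ℕ → Fin m) (y : Fin k → Fin n) (b : Bool) →
  (∀ i j → toℕ j < i → Q (x i) (y j) ≡ b) →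
  (∀ i j → i ≤ toℕ j → Q (x i) (y j) ≡ not b) → k ≤ d
QS-IIP-staircase {d} {k} {Q = Q} q x y b₀ below₀ above₀ with QS-inner q
... | u , v , eq = bound b₀ below₀ above₀
  where
  orthogonal : ∀ i j → Q (x i) (y j) ≡ false → ⟨ u (x i) , v (y j) ⟩ ≡ 0ℤ
  orthogonal i j Q≡ with ⟨ u (x i) , v (y j) ⟩ ℤ.≟ 0ℤ | eq (x i) (y j)
  ... | yes p | _   = p
  ... | no _  | Q≡′ = contradiction (trans (sym Q≡′) Q≡) λ ()
  nonOrthogonal : ∀ i j → Q (x i) (y j) ≡ true → ⟨ u (x i) , v (y j) ⟩ ≢ 0ℤ
  nonOrthogonal i j Q≡ with ⟨ u (x i) , v (y j) ⟩ ℤ.≟ 0ℤ | eq (x i) (y j)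
  ... | no p  | _   = p
  ... | yes _ | Q≡′ = contradiction (trans (sym Q≡) Q≡′) λ ()
  bound : ∀ b → (∀ i j → toℕ j < i → Q (x i) (y j) ≡ b) →
          (∀ i j → i ≤ toℕ j → Q (x i) (y j) ≡ not b) → k ≤ d
  -- Here the cells with `toℕ j < i` are orthogonal. Rows and columns change roles to put these
  -- zeros above the diagonal.
  bound false below above = triangular-bound (v ∘ y) (u ∘ x ∘ toℕ)
    (λ t → nonOrthogonal (toℕ t) t (above _ t ℕ.≤-refl) ∘
           trans (inner-comm (u (x (toℕ t))) (v (y t))))
    (λ {i} {j} i<j → trans (inner-comm (v (y i)) (u (x (toℕ j))))
                           (orthogonal (toℕ j) i (below _ i i<j)))
  -- Here the orthogonal cells include the diagonal, so the rows shift by one: `suc t` is the first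
  -- row not orthogonal to column `t`.
  bound true below above = triangular-bound (u ∘ x ∘ suc ∘ toℕ) (v ∘ y)
    (λ t → nonOrthogonal (suc (toℕ t)) t (below _ t ℕ.≤-refl))
    (λ {i} {j} i<j → orthogonal (suc (toℕ i)) j (above _ j i<j))

-- Protocols

-- Padding with `false` past the leaf makes every answer index a Boolean colouring of all pairs of
-- inputs.
transcript : ∀ {𝓜 : MatrixSet} {N} → Protocol 𝓜 N → Fin N → Fin N → ℕ → Bool
transcript (leaf _)              x y _       = false
transcript (node Q _ left right) x y zero    = Q x y
transcript (node Q _ left right) x y (suc i) =
  transcript (if Q x y then right else left) x y i

Follows : ∀ {𝓜 : MatrixSet} {N} → (ℕ → Bool) → Protocol 𝓜 N → Fin N → Fin N → Set
Follows t Π x y = ∀ {i} → i < cost Π → transcript Π x y i ≡ t i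

module _ {𝓜 : MatrixSet} {N} {Q : Matrix N N} {q : QS 𝓜 Q} {left right : Protocol 𝓜 N}
         {t : ℕ → Bool} {x y : Fin N} (follows : Follows t (node Q q left right) x y) where

  next : Bool → Protocol 𝓜 N
  next b = if b then right else left

  follows-next : ∀ b → t 0 ≡ b → Follows (t ∘ suc) (next b) x y
  follows-next b t≡b {i} i< = trans
    (cong (λ c → transcript (if c then right else left) x y i)
      (sym (trans (follows (s≤s z≤n)) t≡b)))
    (follows (s≤s (ℕ.≤-trans i< (cost-next b))))
    where
    cost-next : ∀ b → cost (next b) ≤ cost left ⊔ cost right
    cost-next true  = ℕ.m≤n⊔m (cost left) (cost right)
    cost-next false = ℕ.m≤m⊔n (cost left) (cost right)

  output-next : ∀ b → t 0 ≡ b → output (node Q q left right) x y ≡ output (next b) x y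
  output-next b t≡b = trans
    (cong (λ c → if c then output right x y else output left x y)
      (trans (follows (s≤s z≤n)) t≡b))
    (sym (Bool.if-float (λ Π → output Π x y) b))

-- At the node where the two transcripts diverge, both classes are still together.
separating-query : ∀ {𝓜 : MatrixSet} {N} (Π : Protocol 𝓜 N)
  (P P′ : Fin N → Fin N → Set) (t t′ : ℕ → Bool) →
  (∀ {x y} → P x y → Follows t Π x y) →
  (∀ {x y} → P′ x y → Follows t′ Π x y) →
  ¬ (∀ {x y x′ y′} → P x y → P′ x′ y′ → output Π x y ≡ output Π x′ y′) →
  ∃₂ λ Q b → QS 𝓜 Q × (∀ {x y} → P x y → Q x y ≡ b) × (∀ {x y} → P′ x y → Q x y ≡ not b)
separating-query (leaf b) P P′ t t′ fol fol′ differ = ⊥-elim (differ λ _ _ → refl)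
separating-query Π@(node Q q left right) P P′ t t′ fol fol′ differ with t 0 in t≡ | t′ 0 in t′≡
... | true  | false = Q , true  , q ,
  (λ p → trans (fol p (s≤s z≤n)) t≡) , (λ p → trans (fol′ p (s≤s z≤n)) t′≡)
... | false | true  = Q , false , q ,
  (λ p → trans (fol p (s≤s z≤n)) t≡) , (λ p → trans (fol′ p (s≤s z≤n)) t′≡)
... | true  | true  = separating-query right P P′ (t ∘ suc) (t′ ∘ suc)
  (λ p → follows-next (fol p) true t≡) (λ p → follows-next (fol′ p) true t′≡)
  (λ same → differ λ p p′ → trans (output-next (fol p) true t≡)
    (trans (same p p′) (sym (output-next (fol′ p′) true t′≡))))
... | false | false = separating-query left P P′ (t ∘ suc) (t′ ∘ suc)
  (λ p → follows-next (fol p) false t≡) (λ p → follows-next (fol′ p) false t′≡)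
  (λ same → differ λ p p′ → trans (output-next (fol p) false t≡)
    (trans (same p p′) (sym (output-next (fol′ p′) false t′≡))))

-- Bit strings with given support

string : ∀ {N} → List (Fin N) → BitString N
string []      p = zero
string (q ∷ L) p = if does (p Fin.≟ q) then suc zero else string L p

string-∉ : ∀ {N} {p : Fin N} L → All (p ≢_) L → string L p ≡ zero
string-∉ [] [] = refl
string-∉ {p = p} (q ∷ L) (p≢q ∷ p∉L) rewrite dec-false (p Fin.≟ q) p≢q = string-∉ L p∉L

mismatch : Fin 2 → Fin 2 → ℕ
mismatch a b = if does (a Fin.≟ b) then 0 else 1

mismatch-refl : ∀ a → mismatch a a ≡ 0
mismatch-refl zero       = refl
mismatch-refl (suc zero) = refl

dist-cong : ∀ {N} {x x′ y y′ : BitString N} → x ≗ x′ → y ≗ y′ → dist x y ≡ dist x′ y′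
dist-cong x≗x′ y≗y′ = ℕΣ.sum-cong-≗ (λ i → cong₂ mismatch (x≗x′ i) (y≗y′ i))

dist-refl : ∀ {N} (x : BitString N) → dist x x ≡ 0
dist-refl {N} x = trans (ℕΣ.sum-cong-≗ (mismatch-refl ∘ x)) (ℕΣ.sum-replicate-zero N)

δ : ∀ {N} → Fin N → Fin N → ℕ
δ p r = if does (r Fin.≟ p) then 1 else 0

sum-δ : ∀ {N} (p : Fin N) → ℕΣ.sum (δ p) ≡ 1
sum-δ {suc N} zero    = cong suc (ℕΣ.sum-replicate-zero N)
sum-δ {suc N} (suc p) = sum-δ p

dist-∷-≡ : ∀ {N} (p : Fin N) L L′ → All (p ≢_) L → All (p ≢_) L′ →
           dist (string (p ∷ L)) (string (p ∷ L′)) ≡ dist (string L) (string L′)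
dist-∷-≡ p L L′ p∉L p∉L′ = ℕΣ.sum-cong-≗ pointwise
  where
  pointwise : ∀ r → mismatch (string (p ∷ L) r) (string (p ∷ L′) r)
                  ≡ mismatch (string L r) (string L′ r)
  pointwise r with r Fin.≟ p
  ... | no _ = refl
  ... | yes refl rewrite string-∉ L p∉L | string-∉ L′ p∉L′ = refl

-- Each of `p` and `q` lies in exactly one of the two supports, so each adds one mismatch.
dist-∷-≢ : ∀ {N} {p q : Fin N} L L′ → p ≢ q →
           All (p ≢_) L → All (p ≢_) L′ → All (q ≢_) L → All (q ≢_) L′ →
           dist (string (p ∷ L)) (string (q ∷ L′)) ≡ 2 + dist (string L) (string L′)
dist-∷-≢ {p = p} {q} L L′ p≢q p∉L p∉L′ q∉L q∉L′ = begin
  dist (string (p ∷ L)) (string (q ∷ L′))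
    ≡⟨ ℕΣ.sum-cong-≗ pointwise ⟩
  ℕΣ.sum (λ r → δ p r + (δ q r + mismatch (string L r) (string L′ r)))
    ≡⟨ ℕΣ.∑-distrib-+ (δ p) _ ⟩
  ℕΣ.sum (δ p) + ℕΣ.sum (λ r → δ q r + mismatch (string L r) (string L′ r))
    ≡⟨ cong (ℕΣ.sum (δ p) +_) (ℕΣ.∑-distrib-+ (δ q) _) ⟩
  ℕΣ.sum (δ p) + (ℕΣ.sum (δ q) + dist (string L) (string L′))
    ≡⟨ cong₂ (λ m n → m + (n + dist (string L) (string L′))) (sum-δ p) (sum-δ q) ⟩
  2 + dist (string L) (string L′) ∎
  where
  open ≡-Reasoning
  pointwise : ∀ r → mismatch (string (p ∷ L) r) (string (q ∷ L′) r)
                  ≡ δ p r + (δ q r + mismatch (string L r) (string L′ r))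
  pointwise r with r Fin.≟ p | r Fin.≟ q
  ... | yes refl | yes refl = contradiction refl p≢q
  ... | yes refl | no _     rewrite string-∉ L p∉L | string-∉ L′ p∉L′ = refl
  ... | no _     | yes refl rewrite string-∉ L q∉L | string-∉ L′ q∉L′ = refl
  ... | no _     | no _     = refl

-- Rows and columns coded by subsets of the blocks

-- `H` is read as consecutive triples, one per block; `lower` gives the supports of rows and `upper`
-- those of columns.
lower upper : ∀ {n} → Subset n → List A → List A
lower (a ∷ S) (x ∷ y ∷ z ∷ H) = (if a then x else y) ∷ lower S H
lower _       _               = []
upper (b ∷ S) (x ∷ y ∷ z ∷ H) = (if b then z else y) ∷ upper S H
upper _       _               = []

-- The list s is read as consecutive pairs; second S takes the second member
-- exactly in the blocks of S.
first : List A → List A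
first (x ∷ y ∷ s) = x ∷ first s
first _           = []

second : ∀ {n} → Subset n → List A → List A
second (b ∷ S) (x ∷ y ∷ s) = (if b then y else x) ∷ second S s
second _       _           = []

-- Row and column can be recovered from a sublist of two positions per block and from `S ∪ T` alone.
-- This is what lets Ramsey's theorem remove the dependence on `S` and `T` beyond their union.
select : ∀ {n} (S T : Subset n) {H : List A} → length H ≡ n * 3 →
  ∃[ s ] s ⊆ H × length s ≡ n * 2 × first s ≡ lower S H × second (S ∪ T) s ≡ upper T H
select []      []      {[]} len = [] , [] , refl , refl , refl
select (a ∷ S) (b ∷ T) {x ∷ y ∷ z ∷ H} len
  with select S T {H} (ℕ.suc-injective (ℕ.suc-injective (ℕ.suc-injective len)))
... | s , s⊆H , lens , eq₁ , eq₂ with a | b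
...   | true  | true  =
        x ∷ z ∷ s , refl ∷ y ∷ʳ refl ∷ s⊆H ,
        cong (2 +_) lens , cong (x ∷_) eq₁ , cong (z ∷_) eq₂
...   | true  | false =
        x ∷ y ∷ s , refl ∷ refl ∷ z ∷ʳ s⊆H ,
        cong (2 +_) lens , cong (x ∷_) eq₁ , cong (y ∷_) eq₂
...   | false | true  =
        y ∷ z ∷ s , x ∷ʳ refl ∷ refl ∷ s⊆H ,
        cong (2 +_) lens , cong (y ∷_) eq₁ , cong (z ∷_) eq₂
-- Both strings use `y` here; `z` only fills the pair.
...   | false | false =
        y ∷ z ∷ s , x ∷ʳ refl ∷ refl ∷ s⊆H ,
        cong (2 +_) lens , cong (y ∷_) eq₁ , cong (y ∷_) eq₂

lower-All : ∀ {n} {P : A → Set} (S : Subset n) {H} → All P H → All P (lower S H)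
lower-All []      _                      = []
lower-All (a ∷ S) []                     = []
lower-All (a ∷ S) (_ ∷ [])               = []
lower-All (a ∷ S) (_ ∷ _ ∷ [])           = []
lower-All (true  ∷ S) (px ∷ py ∷ pz ∷ H) = px ∷ lower-All S H
lower-All (false ∷ S) (px ∷ py ∷ pz ∷ H) = py ∷ lower-All S H

upper-All : ∀ {n} {P : A → Set} (S : Subset n) {H} → All P H → All P (upper S H)
upper-All []      _                      = []
upper-All (a ∷ S) []                     = []
upper-All (a ∷ S) (_ ∷ [])               = []
upper-All (a ∷ S) (_ ∷ _ ∷ [])           = []
upper-All (true  ∷ S) (px ∷ py ∷ pz ∷ H) = pz ∷ upper-All S H
upper-All (false ∷ S) (px ∷ py ∷ pz ∷ H) = py ∷ upper-All S H

-- A block contributes 2, except that it contributes 0 when row and column both use `y`, that is,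
-- outside `S ∪ T`.
dist-lower-upper : ∀ {n N} (S T : Subset n) {H : List (Fin N)} → length H ≡ n * 3 → Unique H →
  dist (string (lower S H)) (string (upper T H)) ≡ ∣ S ∪ T ∣ * 2
dist-lower-upper {N = N} [] [] {[]} len _ = dist-refl {N} (string [])
dist-lower-upper (a ∷ S) (b ∷ T) {x ∷ y ∷ z ∷ H} len
  ((x≢y ∷ x≢z ∷ x∉H) ∷ (y≢z ∷ y∉H) ∷ z∉H ∷ uniq)
  with dist-lower-upper S T {H} (ℕ.suc-injective (ℕ.suc-injective (ℕ.suc-injective len))) uniq
     | a | b
... | ih | true  | true  =
  trans (dist-∷-≢ _ _ x≢z (lower-All S x∉H) (upper-All T x∉H)
                   (lower-All S z∉H) (upper-All T z∉H))
        (cong (2 +_) ih)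
... | ih | true  | false =
  trans (dist-∷-≢ _ _ x≢y (lower-All S x∉H) (upper-All T x∉H)
                   (lower-All S y∉H) (upper-All T y∉H))
        (cong (2 +_) ih)
... | ih | false | true  =
  trans (dist-∷-≢ _ _ y≢z (lower-All S y∉H) (upper-All T y∉H)
                   (lower-All S z∉H) (upper-All T z∉H))
        (cong (2 +_) ih)
... | ih | false | false =
  trans (dist-∷-≡ y _ _ (lower-All S y∉H) (upper-All T y∉H))
        ih

-- Finite sets as lists

Unique-⊆ : {L H : List A} → L ⊆ H → Unique H → Unique L
Unique-⊆ []           []           = []
Unique-⊆ (_ ∷ʳ L⊆H)   (_ ∷ uniq)   = Unique-⊆ L⊆H uniq
Unique-⊆ (refl ∷ L⊆H) (x∉H ∷ uniq) = All-resp-⊆ L⊆H x∉H ∷ Unique-⊆ L⊆H uniq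

removeAt-⊆ : ∀ (L : List A) i → removeAt L i ⊆ L
removeAt-⊆ (x ∷ L) zero    = x ∷ʳ ⊆-refl
removeAt-⊆ (x ∷ L) (suc i) = refl ∷ removeAt-⊆ L i

drop-⊆ : ∀ i (L : List A) → drop i L ⊆ L
drop-⊆ zero    L       = ⊆-refl
drop-⊆ (suc i) []      = []
drop-⊆ (suc i) (x ∷ L) = x ∷ʳ drop-⊆ i L

subsets : ∀ n → List (Subset n)
subsets zero    = [] ∷ []
subsets (suc n) = map (true ∷_) (subsets n) ++ map (false ∷_) (subsets n)

∈-subsets : ∀ {n} (S : Subset n) → S ∈ subsets n
∈-subsets []          = here refl
∈-subsets (true ∷ S)  = ∈-++⁺ˡ (∈-map⁺ (true ∷_) (∈-subsets S))
∈-subsets (false ∷ S) = ∈-++⁺ʳ _ (∈-map⁺ (false ∷_) (∈-subsets S))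

fromList : ∀ {n} → List (Fin n) → Subset n
fromList []      = ⊥
fromList (p ∷ L) = ⁅ p ⁆ ∪ fromList L

fromList-∉ : ∀ {n} {p : Fin n} L → All (p ≢_) L → p ∉ₛ fromList L
fromList-∉ []      []          p∈ = ∉⊥ p∈
fromList-∉ (q ∷ L) (p≢q ∷ p∉L) p∈ with x∈p∪q⁻ ⁅ q ⁆ (fromList L) p∈
... | inj₁ p∈q = p≢q (x∈⁅y⁆⇒x≡y q p∈q)
... | inj₂ p∈L = fromList-∉ L p∉L p∈L

∣⁅p⁆∪S∣ : ∀ {n} (p : Fin n) (S : Subset n) → p ∉ₛ S → ∣ ⁅ p ⁆ ∪ S ∣ ≡ suc ∣ S ∣
∣⁅p⁆∪S∣ zero    (true  ∷ S) p∉S = contradiction here p∉S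
∣⁅p⁆∪S∣ zero    (false ∷ S) p∉S = cong (suc ∘ ∣_∣) (∪-identityˡ S)
∣⁅p⁆∪S∣ (suc p) (true  ∷ S) p∉S = cong suc (∣⁅p⁆∪S∣ p S (p∉S ∘ there))
∣⁅p⁆∪S∣ (suc p) (false ∷ S) p∉S = ∣⁅p⁆∪S∣ p S (p∉S ∘ there)

∣fromList∣ : ∀ {n} (L : List (Fin n)) → Unique L → ∣ fromList L ∣ ≡ length L
∣fromList∣ {n} []  []       = ∣⊥∣≡0 n
∣fromList∣ (p ∷ L) (p∉L ∷ uniq) =
  trans (∣⁅p⁆∪S∣ p (fromList L) (fromList-∉ L p∉L)) (cong suc (∣fromList∣ L uniq))

∪-leftComm : ∀ {n} (p q r : Subset n) → p ∪ (q ∪ r) ≡ q ∪ (p ∪ r)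
∪-leftComm p q r = trans (sym (∪-assoc p q r)) (trans (cong (_∪ r) (∪-comm p q)) (∪-assoc q p r))

fromList-absorbs : ∀ {n} {L M : List (Fin n)} → L ⊆ M → fromList L ∪ fromList M ≡ fromList M
fromList-absorbs [] = ∪-idem ⊥
fromList-absorbs {L = L} {q ∷ M} (_ ∷ʳ L⊆M) =
  trans (∪-leftComm (fromList L) ⁅ q ⁆ (fromList M)) (cong (⁅ q ⁆ ∪_) (fromList-absorbs L⊆M))
fromList-absorbs {L = p ∷ L} {_ ∷ M} (refl ∷ L⊆M) = begin
  (⁅ p ⁆ ∪ fromList L) ∪ (⁅ p ⁆ ∪ fromList M)  ≡⟨ ∪-leftComm _ ⁅ p ⁆ (fromList M) ⟩
  ⁅ p ⁆ ∪ ((⁅ p ⁆ ∪ fromList L) ∪ fromList M)  ≡⟨ cong (⁅ p ⁆ ∪_) (∪-assoc ⁅ p ⁆ _ _) ⟩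
  ⁅ p ⁆ ∪ (⁅ p ⁆ ∪ (fromList L ∪ fromList M))  ≡⟨ ∪-assoc ⁅ p ⁆ ⁅ p ⁆ _ ⟨
  (⁅ p ⁆ ∪ ⁅ p ⁆) ∪ (fromList L ∪ fromList M)  ≡⟨ cong₂ _∪_ (∪-idem ⁅ p ⁆) (fromList-absorbs L⊆M) ⟩
  ⁅ p ⁆ ∪ fromList M                           ∎
  where open ≡-Reasoning

-- The element at `j`, missing from the facet, is restored by `drop i M` because its position is not
-- among the first `i`.
drop∪removeAt-above : ∀ {n} i (M : List (Fin n)) j → i ≤ toℕ j →
                      fromList (drop i M) ∪ fromList (removeAt M j) ≡ fromList M
drop∪removeAt-above zero    M       j       i≤j =
  trans (∪-comm _ _) (fromList-absorbs (removeAt-⊆ M j))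
drop∪removeAt-above (suc i) (p ∷ M) (suc j) (s≤s i≤j) =
  trans (∪-leftComm _ ⁅ p ⁆ _) (cong (⁅ p ⁆ ∪_) (drop∪removeAt-above i M j i≤j))

drop∪removeAt-below : ∀ {n} i (M : List (Fin n)) j → toℕ j < i →
                      fromList (drop i M) ∪ fromList (removeAt M j) ≡ fromList (removeAt M j)
drop∪removeAt-below (suc i) (p ∷ M) zero    j<i = fromList-absorbs (drop-⊆ i M)
drop∪removeAt-below (suc i) (p ∷ M) (suc j) (s≤s j<i) =
  trans (∪-leftComm _ ⁅ p ⁆ _) (cong (⁅ p ⁆ ∪_) (drop∪removeAt-below i M j j<i))

-- Homogeneous codings

code : ∀ {N} → List (Fin N) → Fin (2 ^ N)
code L = funToFin (string L)

dist-code : ∀ {N} (L L′ : List (Fin N)) →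
            dist (bits {N} (code L)) (bits (code L′)) ≡ dist (string L) (string L′)
dist-code L L′ = dist-cong (Fin.finToFun-funToFin (string L)) (Fin.finToFun-funToFin (string L′))

-- `N` is fixed before `τ`, since a protocol is only given once the string length is known. There is
-- one colouring for each possible union and each answer index.
union-coding : ∀ n c → ∃[ N ] ∀ (τ : Fin (2 ^ N) → Fin (2 ^ N) → ℕ → Bool) →
  ∃₂ λ (x y : Subset n → Fin (2 ^ N)) →
    (∀ S T → dist (bits {N} (x S)) (bits (y T)) ≡ ∣ S ∪ T ∣ * 2) ×
    (∀ S T {i} → i < c → τ (x S) (y T) i ≡ τ (x (S ∪ T)) (y (S ∪ T)) i)
union-coding n c = N , coding
  where
  colourings : List (Subset n × ℕ)
  colourings = cartesianProduct (subsets n) (upTo c)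
  -- Sublists with two positions per block are coloured; three positions per block are kept.
  N = ramseyNumbers (n * 2) colourings (n * 3)
  coding : ∀ (τ : Fin (2 ^ N) → Fin (2 ^ N) → ℕ → Bool) → ∃₂ λ x y → _
  coding τ with ramsey-all (n * 2) colourings
                  (λ { (U , i) s → τ (code (first s)) (code (second U s)) i })
                  {allFin N} (length-tabulate id)
  ... | H , H⊆ , len , monos =
    code ∘ (λ S → lower S H) , code ∘ (λ T → upper T H) ,
    (λ S T → trans (dist-code (lower S H) (upper T H))
                   (dist-lower-upper S T len (Unique-⊆ H⊆ (allFin⁺ N)))) ,
    depends
    where
    depends : ∀ S T {i} → i < c → τ (code (lower S H)) (code (upper T H)) i
                                ≡ τ (code (lower (S ∪ T) H)) (code (upper (S ∪ T) H)) i
    -- The pairs `S`, `T` and `S ∪ T`, `S ∪ T` have the same union, so both are read off from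
    -- sublists of `H` under the same colouring.
    depends S T {i} i<c
      with All.lookup monos (∈-cartesianProduct⁺ (∈-subsets (S ∪ T)) (∈-upTo⁺ i<c))
         | select S T len | select (S ∪ T) (S ∪ T) len
    ... | b , mono | s , s⊆H , lens , eq₁ , eq₂ | s′ , s′⊆H , lens′ , eq₁′ , eq₂′ = begin
      τ (code (lower S H)) (code (upper T H)) i
        ≡⟨ cong₂ (λ L L′ → τ (code L) (code L′) i) eq₁ eq₂ ⟨
      τ (code (first s)) (code (second (S ∪ T) s)) i
        ≡⟨ mono s⊆H lens ⟩
      b
        ≡⟨ mono s′⊆H lens′ ⟨
      τ (code (first s′)) (code (second (S ∪ T) s′)) i
        ≡⟨ cong₂ (λ L L′ → τ (code L) (code L′) i) eq₁′
             (trans (cong (λ U → second U s′) (sym (∪-idem (S ∪ T)))) eq₂′) ⟩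
      τ (code (lower (S ∪ T) H)) (code (upper (S ∪ T) H)) i ∎
      where open ≡-Reasoning

-- Facets of `M` are its sublists of length `d`, so Ramsey's theorem for `d`-sublists applies, with
-- one colouring per answer index.
uniform-facets : ∀ d c → ∃[ n ] ∀ (Γ : Subset n → ℕ → Bool) →
  ∃[ M ] length M ≡ suc d × Unique M ×
    (∀ j j′ {i} → i < c → Γ (fromList (removeAt M j)) i ≡ Γ (fromList (removeAt M j′)) i)
uniform-facets d c = n , facets
  where
  n = ramseyNumbers d (upTo c) (suc d)
  facets : ∀ (Γ : Subset n → ℕ → Bool) → ∃ λ M → _
  facets Γ with ramsey-all d (upTo c) (λ i s → Γ (fromList s) i) {allFin n} (length-tabulate id)
  ... | M , M⊆ , len , monos = M , len , Unique-⊆ M⊆ (allFin⁺ n) , same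
    where
    len-facet : ∀ j → length (removeAt M j) ≡ d
    len-facet j = trans (length-removeAt M j) (cong ℕ.pred len)
    same : ∀ j j′ {i} → i < c → Γ (fromList (removeAt M j)) i ≡ Γ (fromList (removeAt M j′)) i
    same j j′ i<c with All.lookup monos (∈-upTo⁺ i<c)
    ... | b , mono = trans (mono (removeAt-⊆ M j) (len-facet j))
                         (sym (mono (removeAt-⊆ M j′) (len-facet j′)))

-- Facets against the full set of blocks

theorem1p4 : (d : ℕ) → 1 ≤ d → ∃[ k ] ¬ (EHD k ReducesTo IIP d)
-- A facet has `d` blocks, so `d * 2` is the distance when the union is a facet.
theorem1p4 d _ = d * 2 , irreducible
  where
  irreducible : ¬ (EHD (d * 2) ReducesTo IIP d)
  irreducible (c , reduction) with uniform-facets d c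
  ... | n , facets with union-coding n c
  ...   | N , coding with reduction N
  ...     | Π , computes , cost≤c with coding (transcript Π)
  ...       | x , y , dist-xy , transcript-xy with facets (λ U → transcript Π (x U) (y U))
  ...         | m ∷ M , len , uniq , same =
    contradiction (staircase (separating-query Π Below Above _ _ below above differ)) ℕ.1+n≰n
    where
    -- `L` is the full set of `suc d` blocks. Its tail `M` is the facet `removeAt L zero`, whose
    -- transcript represents all facets.
    L = m ∷ M
    row : ℕ → Fin (2 ^ N)
    row i = x (fromList (drop i L))
    col : Fin (length L) → Fin (2 ^ N)
    col j = y (fromList (removeAt L j))
    Below Above : Fin (2 ^ N) → Fin (2 ^ N) → Set
    Below r s = ∃₂ λ i j → toℕ j < i × r ≡ row i × s ≡ col j
    Above r s = ∃₂ λ i j → i ≤ toℕ j × r ≡ row i × s ≡ col j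
    Γ : Subset n → ℕ → Bool
    Γ U = transcript Π (x U) (y U)
    below : ∀ {r s} → Below r s → Follows (Γ (fromList M)) Π r s
    below (i , j , j<i , refl , refl) {t} t< =
      trans (transcript-xy _ _ t<c)
        (trans (cong (λ U → Γ U t) (drop∪removeAt-below i L j j<i)) (same j zero t<c))
      where t<c = ℕ.≤-trans t< cost≤c
    above : ∀ {r s} → Above r s → Follows (Γ (fromList L)) Π r s
    above (i , j , i≤j , refl , refl) {t} t< =
      trans (transcript-xy _ _ (ℕ.≤-trans t< cost≤c))
            (cong (λ U → Γ U t) (drop∪removeAt-above i L j i≤j))
    value : ∀ i j U → fromList (drop i L) ∪ fromList (removeAt L j) ≡ U →
            output Π (row i) (col j) ≡ does (∣ U ∣ * 2 ℕ.≟ d * 2)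
    value i j U eq = trans (computes _ _)
      (cong (λ e → does (e ℕ.≟ d * 2)) (trans (dist-xy _ _) (cong (λ V → ∣ V ∣ * 2) eq)))
    ∣M∣ : ∣ fromList M ∣ ≡ d
    ∣M∣ = trans (∣fromList∣ M (AllPairs.tail uniq)) (ℕ.suc-injective len)
    ∣L∣ : ∣ fromList L ∣ ≡ suc d
    ∣L∣ = trans (∣fromList∣ L uniq) len
    ∣L∣*2≢ : ∣ fromList L ∣ * 2 ≢ d * 2
    ∣L∣*2≢ e = ℕ.1+n≢n (trans (sym ∣L∣) (ℕ.*-cancelʳ-≡ _ _ 2 e))
    differ : ¬ (∀ {r s r′ s′} → Below r s → Above r′ s′ → output Π r s ≡ output Π r′ s′)
    -- One cell of each class suffices: row 1 and column 0 have union `M`, row 0 and column 0 have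
    -- union `L`.
    differ agree = contradiction true≡false λ ()
      where
      true≡false : true ≡ false
      true≡false = begin
        true                                 ≡⟨ dec-true (_ ℕ.≟ d * 2) (cong (_* 2) ∣M∣) ⟨
        does (∣ fromList M ∣ * 2 ℕ.≟ d * 2)  ≡⟨ value 1 zero _ (drop∪removeAt-below 1 L zero (s≤s z≤n)) ⟨
        output Π (row 1) (col zero)          ≡⟨ agree (1 , zero , s≤s z≤n , refl , refl)
                                                      (0 , zero , z≤n , refl , refl) ⟩
        output Π (row 0) (col zero)          ≡⟨ value 0 zero _ (drop∪removeAt-above 0 L zero z≤n) ⟩
        does (∣ fromList L ∣ * 2 ℕ.≟ d * 2)  ≡⟨ dec-false (_ ℕ.≟ d * 2) ∣L∣*2≢ ⟩
        false                                ∎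
        where open ≡-Reasoning
    staircase : (∃₂ λ Q b → QS (Matrices (IIP d)) Q ×
                 (∀ {r s} → Below r s → Q r s ≡ b) ×
                 (∀ {r s} → Above r s → Q r s ≡ not b)) → suc d ≤ d
    staircase (Q , b , q , Q-below , Q-above) = subst (_≤ d) len
      (QS-IIP-staircase q row col b
        (λ i j j<i → Q-below (i , j , j<i , refl , refl))
        (λ i j i≤j → Q-above (i , j , i≤j , refl , refl)))
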